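{- For every non-trivial simple connected graph $G$ of order $n$ (that is, $n\ge 2$), the following facts hold: (i) $1\le \dim_{ms}(G)\le n-1$; (ii) $\dim_{ms}(G)\ge \dim(G)$.
   Context: Graphs are finite, simple and connected; $d_G(u,v)$ is the length of a shortest $u$–$v$ path. For $S=\{w_1,\ldots,w_t\}\subseteq V(G)$ and $u\in V(G)$, the multiset representation of $u$ with respect to $S$ is the multiset $\operatorname{m}(u|S)$ consisting of $d_G(u,w_1),\ldots,d_G(u,w_t)$, counted with multiplicity, and the metric representation of $u$ (with $S$ ordered) is the vector $\operatorname{r}(u|S)=(d_G(u,w_1),\ldots,d_G(u,w_t))$. A set $S$ is an outer multiset resolving set if $\operatorname{m}(u|S)\ne \operatorname{m}(v|S)$ for every two distinct $u,v\in V(G)\setminus S$; the outer multiset dimension $\dim_{ms}(G)$ is the minimum cardinality of such a set. A set $S$ is a resolving set if $\operatorname{r}(u|S)\neq \operatorname{r}(v|S)$ for every two distinct $u,v\in V(G)$; the metric dimension $\dim(G)$ is the minimum cardinality of a resolving set. -}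

module Defs where

open import Data.Fin.Base using (Fin)
open import Data.Fin.Properties as Fin using (any?; all?)
open import Data.Fin.Subset using (Subset; ∣_∣; _∈_; _∉_; ⊤)
open import Data.Fin.Subset.Properties using (_∈?_; ∈⊤; ∣⊤∣≡n; anySubset?)
open import Data.List.Base as List using (List; filter; allFin; []; _∷_)
import Data.List.Membership.Propositional as List
open import Data.List.Membership.Propositional.Properties using (∈-filter⁺; ∈-allFin)
open import Data.List.Properties using (≡-dec; ∷-injectiveˡ; ∷-injectiveʳ)
open import Data.List.Relation.Binary.Permutation.Propositional using (_↭_; ↭-trans; ↭-sym; ↭-reflexive; ↭⇒↭ₛ)
open import Data.List.Relation.Binary.Pointwise using (Pointwise-≡⇒≡)
open import Data.List.Relation.Unary.Any using (here; there)
open import Data.List.Relation.Unary.Sorted.TotalOrder.Properties using (↗↭↗⇒≋)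
import Data.List.Sort as Sort
open import Data.Nat.Base using (ℕ; zero; suc; _≤_; z≤n; s≤s)
open import Data.Nat.Properties as ℕ using (n≤0⇒n≡0)
open import Data.Product.Base using (Σ; ∃; _×_; _,_; proj₁; proj₂)
open import Data.Vec.Base as Vec using (Vec; []; _∷_)
open import Data.Vec.Relation.Unary.All using ([])
open import Data.Vec.Relation.Unary.AllPairs using ([]; _∷_; allPairs?)
open import Data.Vec.Relation.Unary.Linked using (Linked; [-]; linked?)
open import Data.Vec.Relation.Unary.Unique.Propositional using (Unique)
open import Level using (0ℓ)
open import Relation.Binary.Core using (Rel)
import Relation.Binary.Definitions as B
open import Relation.Binary.PropositionalEquality using (_≡_; _≢_; refl; sym; trans)
open import Relation.Nullary using (Dec; yes; no; ¬_; contradiction)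
open import Relation.Nullary.Decidable using (map′; _×-dec_; _→-dec_; ¬?)
open import Relation.Unary using (Pred; Decidable)

-- A finite simple graph with vertex set Fin n, i.e. of order n.
record Graph (n : ℕ) : Set₁ where
  infix 4 _~_ _~?_
  field
    _~_    : Rel (Fin n) 0ℓ
    _~?_   : B.Decidable _~_
    ~-sym  : B.Symmetric _~_
    ~-irr  : B.Irreflexive _≡_ _~_

-- Least elements of decidable predicates on ℕ.  Distances and dimensions
-- below are first components of values of type `Minimum P`, so their second
-- components are the defining properties.

Minimum : Pred ℕ 0ℓ → Set
Minimum P = Σ ℕ λ k → P k × (∀ j → P j → k ≤ j)

minimum : {P : Pred ℕ 0ℓ} → Decidable P → ∀ m → P m → Minimum P
minimum P? zero p = zero , p , λ _ _ → z≤n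
minimum {P} P? (suc m) p with P? zero
... | yes p₀ = zero , p₀ , λ _ _ → z≤n
... | no ¬p₀ with minimum (λ k → P? (suc k)) m p
...   | k , pk , least = suc k , pk , below
  where
  below : ∀ j → P j → suc k ≤ j
  below zero    p₀ = contradiction p₀ ¬p₀
  below (suc j) pj = s≤s (least j pj)

anyVec? : ∀ {n} k {P : Pred (Vec (Fin n) k) 0ℓ} → Decidable P → Dec (∃ P)
anyVec? zero    P? = map′ ([] ,_) (λ { ([] , p) → p }) (P? [])
anyVec? (suc k) P? =
  map′ (λ (x , xs , p) → x ∷ xs , p) (λ { (x ∷ xs , p) → x , xs , p })
       (any? λ x → anyVec? k λ xs → P? (x ∷ xs))

infix 4 _↭?_
_↭?_ : (xs ys : List ℕ) → Dec (xs ↭ ys)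
xs ↭? ys = map′
  (λ eq → ↭-trans (↭-sym (sort-↭ xs)) (↭-trans (↭-reflexive eq) (sort-↭ ys)))
  (λ p → Pointwise-≡⇒≡ (↗↭↗⇒≋ ℕ.≤-totalOrder (sort-↗ xs) (sort-↗ ys)
           (↭⇒↭ₛ (↭-trans (sort-↭ xs) (↭-trans p (↭-sym (sort-↭ ys)))))))
  (≡-dec ℕ._≟_ (sort xs) (sort ys))
  where open Sort ℕ.≤-decTotalOrder using (sort; sort-↭; sort-↗)

-- The distinct vertices u = x₀ ~ x₁ ~ … ~ xₖ = v of a path with k edges.
IsPath : ∀ {n} → Graph n → Fin n → Fin n → (k : ℕ) → Vec (Fin n) (suc k) → Set
IsPath G u v k xs =
  Vec.head xs ≡ u × Vec.last xs ≡ v × Linked (Graph._~_ G) xs × Unique xs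

Path : ∀ {n} → Graph n → Fin n → Fin n → ℕ → Set
Path G u v k = ∃ (IsPath G u v k)

path? : ∀ {n} (G : Graph n) u v → Decidable (Path G u v)
path? G u v k = anyVec? (suc k) λ xs →
  (Vec.head xs Fin.≟ u) ×-dec (Vec.last xs Fin.≟ v) ×-dec
  linked? (Graph._~?_ G) xs ×-dec allPairs? (λ x y → ¬? (x Fin.≟ y)) xs

Connected : ∀ {n} → Graph n → Set
Connected G = ∀ u v → ∃ (Path G u v)

elements : ∀ {n} → Subset n → List (Fin n)
elements S = filter (_∈? S) (allFin _)

module _ {n : ℕ} (G : Graph n) (conn : Connected G) where

  shortestPath : ∀ u v → Minimum (Path G u v)
  shortestPath u v = minimum (path? G u v) (proj₁ (conn u v)) (proj₂ (conn u v))

  dist : Fin n → Fin n → ℕ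
  dist u v = proj₁ (shortestPath u v)

  -- m(u|S) and r(u|S) are given by the same list of distances: `_↭_` compares
  -- it as a multiset and `_≡_` as a vector, S being ordered as Fin n is.
  distances : Fin n → Subset n → List ℕ
  distances u S = List.map (dist u) (elements S)

  IsOuterMultisetResolving : Subset n → Set
  IsOuterMultisetResolving S = ∀ u v → u ∉ S → v ∉ S → u ≢ v →
    ¬ (distances u S ↭ distances v S)

  IsResolving : Subset n → Set
  IsResolving S = ∀ u v → u ≢ v → distances u S ≢ distances v S

  isOuterMultisetResolving? : Decidable IsOuterMultisetResolving
  isOuterMultisetResolving? S = all? λ u → all? λ v →
    ¬? (u ∈? S) →-dec ¬? (v ∈? S) →-dec ¬? (u Fin.≟ v) →-dec
    ¬? (distances u S ↭? distances v S)

  isResolving? : Decidable IsResolving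
  isResolving? S = all? λ u → all? λ v →
    ¬? (u Fin.≟ v) →-dec ¬? (≡-dec ℕ._≟_ (distances u S) (distances v S))

  dist-refl : ∀ u → dist u u ≡ 0
  dist-refl u = n≤0⇒n≡0 (proj₂ (proj₂ (shortestPath u u)) 0
    (u ∷ [] , refl , refl , [-] , [] ∷ []))

  dist≡0⇒≡ : ∀ u v → dist u v ≡ 0 → u ≡ v
  dist≡0⇒≡ u v eq with shortestPath u v
  dist≡0⇒≡ u v refl | .0 , (x ∷ [] , x≡u , x≡v , _) , _ = trans (sym x≡u) x≡v

  map-≡⇒≡ : ∀ {f g : Fin n → ℕ} {x} xs → x List.∈ xs →
            List.map f xs ≡ List.map g xs → f x ≡ g x
  map-≡⇒≡ (x ∷ xs) (here refl) eq = ∷-injectiveˡ eq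
  map-≡⇒≡ (y ∷ xs) (there x∈)  eq = map-≡⇒≡ xs x∈ (∷-injectiveʳ eq)

  ⊤-isOuterMultisetResolving : IsOuterMultisetResolving ⊤
  ⊤-isOuterMultisetResolving u v u∉ _ _ _ = u∉ ∈⊤

  ⊤-isResolving : IsResolving ⊤
  ⊤-isResolving u v u≢v eq = u≢v (dist≡0⇒≡ u v
    (trans (map-≡⇒≡ (elements ⊤) (∈-filter⁺ (_∈? ⊤) (∈-allFin v) ∈⊤) eq)
           (dist-refl v)))

  minOuterMultisetResolving :
    Minimum (λ k → ∃ λ S → ∣ S ∣ ≡ k × IsOuterMultisetResolving S)
  minOuterMultisetResolving = minimum
    (λ k → anySubset? λ S → (∣ S ∣ ℕ.≟ k) ×-dec isOuterMultisetResolving? S)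
    n (⊤ , ∣⊤∣≡n n , ⊤-isOuterMultisetResolving)

  minResolving : Minimum (λ k → ∃ λ S → ∣ S ∣ ≡ k × IsResolving S)
  minResolving = minimum
    (λ k → anySubset? λ S → (∣ S ∣ ℕ.≟ k) ×-dec isResolving? S)
    n (⊤ , ∣⊤∣≡n n , ⊤-isResolving)

  dimₘₛ : ℕ
  dimₘₛ = proj₁ minOuterMultisetResolving

  dim : ℕ
  dim = proj₁ minResolving

{-# OPTIONS --safe #-}

module Submission where

open import Data.Fin.Base using (Fin; zero; suc)
open import Data.Fin.Subset using (Subset; ∣_∣; _-_; _∈_; _∉_; ⊤; outside)
open import Data.Fin.Subset.Properties using (_∈?_; ∈⊤; ∣⊤∣≡n; x∈p⇒∣p-x∣<∣p∣)
open import Data.List.Base using ([]; map; allFin)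
open import Data.List.Membership.Propositional.Properties using (∈-filter⁺; ∈-allFin)
open import Data.List.Properties using (filter-none)
open import Data.List.Relation.Binary.Permutation.Propositional using (↭-reflexive)
open import Data.List.Relation.Unary.All using (universal)
open import Data.Nat.Base using (ℕ; suc; _≤_; _<_; _≥_; _∸_; z≤n; s≤s)
open import Data.Nat.Properties using (n≢0⇒n>0; n≮0)
open import Data.Product.Base using (_×_; _,_; proj₁; proj₂; map₂)
open import Data.Vec.Base using (_∷_; there)
open import Relation.Binary.PropositionalEquality using (_≡_; _≢_; refl; sym; trans; cong; subst)
open import Relation.Nullary using (yes; no; contradiction)
open import Defs

-- Lower bound: the empty set gives every vertex the empty multiset, so it fails as soon as there
-- are two distinct vertices. Upper bound: if all vertices but one are in `S`, no two distinct
-- vertices remain outside to be separated. Comparison with `dim`: every outer multiset resolving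
-- set is resolving, so minimality of `dim` applies to a set attaining `dimₘₛ`.

∣p∣≡0⇒x∉p : ∀ {n} (p : Subset n) → ∣ p ∣ ≡ 0 → ∀ x → x ∉ p
∣p∣≡0⇒x∉p p ∣p∣≡0 x x∈p = n≮0 (subst (∣ p - x ∣ <_) ∣p∣≡0 (x∈p⇒∣p-x∣<∣p∣ x∈p))

∣p∣≡0⇒elements≡[] : ∀ {n} (p : Subset n) → ∣ p ∣ ≡ 0 → elements p ≡ []
∣p∣≡0⇒elements≡[] p ∣p∣≡0 =
  filter-none (_∈? p) (universal (∣p∣≡0⇒x∉p p ∣p∣≡0) (allFin _))

module _ {n : ℕ} (G : Graph n) (conn : Connected G) where

  -- A landmark identifies itself: the coordinate of the vector indexed by `u` is 0 for `u`, and
  -- only `u` is at distance 0 from `u`.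
  distances-≡⇒≡ : ∀ {u v S} → u ∈ S →
    distances G conn u S ≡ distances G conn v S → v ≡ u
  distances-≡⇒≡ {u} {v} {S} u∈S eq = dist≡0⇒≡ G conn v u
    (trans (sym (map-≡⇒≡ G conn (elements S) (∈-filter⁺ (_∈? S) (∈-allFin u) u∈S) eq))
           (dist-refl G conn u))

  -- If either vertex lies in `S`, its own zero coordinate separates the pair. If both lie outside,
  -- equal vectors would be equal multisets, contradicting the hypothesis.
  outerMultisetResolving⇒resolving : ∀ {S} →
    IsOuterMultisetResolving G conn S → IsResolving G conn S
  outerMultisetResolving⇒resolving {S} outer u v u≢v eq with u ∈? S | v ∈? S
  ... | yes u∈S | _       = u≢v (sym (distances-≡⇒≡ u∈S eq))
  ... | no  _   | yes v∈S = u≢v (distances-≡⇒≡ v∈S (sym eq))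
  ... | no  u∉S | no  v∉S = outer u v u∉S v∉S u≢v (↭-reflexive eq)

  dim≤dimₘₛ : dim G conn ≤ dimₘₛ G conn
  dim≤dimₘₛ = proj₂ (proj₂ (minResolving G conn)) (dimₘₛ G conn)
    (map₂ (map₂ outerMultisetResolving⇒resolving)
          (proj₁ (proj₂ (minOuterMultisetResolving G conn))))

  outerMultisetResolving⇒∣S∣≢0 : ∀ {S u v} → u ≢ v →
    IsOuterMultisetResolving G conn S → ∣ S ∣ ≢ 0
  outerMultisetResolving⇒∣S∣≢0 {S} {u} {v} u≢v outer ∣S∣≡0 =
    outer u v (∣p∣≡0⇒x∉p S ∣S∣≡0 u) (∣p∣≡0⇒x∉p S ∣S∣≡0 v) u≢v
      (↭-reflexive (trans (distances≡[] u) (sym (distances≡[] v))))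
    where
    distances≡[] : ∀ w → distances G conn w S ≡ []
    distances≡[] w = cong (map (dist G conn w)) (∣p∣≡0⇒elements≡[] S ∣S∣≡0)

  1≤dimₘₛ : ∀ {u v : Fin n} → u ≢ v → 1 ≤ dimₘₛ G conn
  1≤dimₘₛ u≢v =
    let S , ∣S∣≡k , outer = proj₁ (proj₂ (minOuterMultisetResolving G conn))
    in subst (1 ≤_) ∣S∣≡k (n≢0⇒n>0 (outerMultisetResolving⇒∣S∣≢0 u≢v outer))

module _ {m : ℕ} (G : Graph (suc m)) (conn : Connected G) where

  outside∷⊤-isOuterMultisetResolving : IsOuterMultisetResolving G conn (outside ∷ ⊤)
  outside∷⊤-isOuterMultisetResolving zero    zero    _  _  u≢v _ = u≢v refl
  outside∷⊤-isOuterMultisetResolving (suc _) _       u∉ _  _   _ = u∉ (there ∈⊤)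
  outside∷⊤-isOuterMultisetResolving zero    (suc _) _  v∉ _   _ = v∉ (there ∈⊤)

  dimₘₛ≤m : dimₘₛ G conn ≤ m
  dimₘₛ≤m = proj₂ (proj₂ (minOuterMultisetResolving G conn)) m
    -- Leaving out vertex `zero` makes the cardinality reduce to that of `⊤` on the other `m`
    -- vertices.
    (outside ∷ ⊤ , ∣⊤∣≡n m , outside∷⊤-isOuterMultisetResolving)

mainTheorem4 : ∀ (n : ℕ) (G : Graph n) (conn : Connected G) → n ≥ 2 →
    (1 ≤ dimₘₛ G conn × dimₘₛ G conn ≤ n ∸ 1) × dimₘₛ G conn ≥ dim G conn
-- Matching on `n ≥ 2` exposes the distinct vertices `zero` and `suc zero` and lets `n ∸ 1` reduce
-- to the `m` of `dimₘₛ≤m`.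
mainTheorem4 (suc (suc _)) G conn (s≤s (s≤s z≤n)) =
  (1≤dimₘₛ G conn {zero} {suc zero} (λ ()) , dimₘₛ≤m G conn) , dim≤dimₘₛ G conn
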